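{- Let $\mathcal Q$ be a quasivariety in a finite language which has the finite model property and equationally definable principal relative congruences, and assume that its free algebra $\mathbf F$ of countably infinite rank has a finite $\mathcal Q$-simple subalgebra $\mathbf C$. Then $\mathcal Q$ is almost structurally complete if and only if for every finite $\mathcal Q$-subdirectly irreducible algebra $\mathbf S$, either $\mathbf S$ embeds into $\mathbf F$ or $\mathbf S\times\mathbf C$ embeds into $\mathbf F$.
   Context: A quasi-identity is a sentence $q=(\forall\bar x)[\varphi(\bar x)\to\psi(\bar x)]$ with $\varphi$ a finite conjunction of equations and $\psi$ an equation; $q^*=(\forall\bar x)\neg\varphi(\bar x)$. $\mathbf F$ is the free algebra for $\mathcal Q$ over a countably infinite set. A quasi-identity true in $\mathbf F$ is $\mathcal Q$-active if $q^*$ fails in $\mathbf F$; $\mathcal Q$ is almost structurally complete if every $\mathcal Q$-active quasi-identity holds in $\mathcal Q$. A congruence $\alpha$ of $\mathbf A$ is a $\mathcal Q$-congruence if $\mathbf A/\alpha\in\mathcal Q$. A nontrivial algebra is $\mathcal Q$-simple if its only $\mathcal Q$-congruences are the equality and the total relation; a nontrivial $\mathbf S\in\mathcal Q$ is $\mathcal Q$-subdirectly irreducible if equality is completely meet-irreducible in its lattice of $\mathcal Q$-congruences. $\mathcal Q$ has the finite model property if the variety generated by $\mathcal Q$ is generated (as a variety) by the finite members of $\mathcal Q$. $\mathcal Q$ has equationally definable principal relative congruences if there are finitely many equations $s_k(u,v,x,y)\approx t_k(u,v,x,y)$, $k\le n$, such that for all $\mathbf A\in\mathcal Q$ and $a,b,c,d\in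 A$: $(c,d)$ lies in the least $\mathcal Q$-congruence containing $(a,b)$ iff $\mathbf A\models\bigwedge_{k\le n}s_k(c,d,a,b)\approx t_k(c,d,a,b)$. -}

module Defs where

open import Level using (Level; _⊔_; 0ℓ) renaming (suc to lsuc)
open import Data.Nat using (ℕ)
open import Data.Fin using (Fin)
open import Data.Product using (Σ; Σ-syntax; ∃; _×_; _,_; proj₁; proj₂)
open import Data.Sum using (_⊎_)
open import Data.List using (List)
open import Data.List.Relation.Unary.All using (All)
open import Relation.Binary using (Rel; IsEquivalence)
open import Relation.Nullary using (¬_)
open import Relation.Binary.PropositionalEquality using (_≡_)
open import Function.Bundles using (_⇔_)

record Signature : Set where
  field
    nOps  : ℕ
    arity : Fin nOps → ℕ
open Signature public

module _ (σ : Signature) where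

  data Term (X : Set) : Set where
    var : X → Term X
    op  : (f : Fin (nOps σ)) → (Fin (arity σ f) → Term X) → Term X

  record Algebra (c ℓ : Level) : Set (lsuc (c ⊔ ℓ)) where
    field
      Carrier       : Set c
      _≈_           : Rel Carrier ℓ
      isEquivalence : IsEquivalence _≈_
      ⟦_⟧           : (f : Fin (nOps σ)) → (Fin (arity σ f) → Carrier) → Carrier
      ⟦⟧-cong       : ∀ f {xs ys : Fin (arity σ f) → Carrier} →
                      (∀ i → xs i ≈ ys i) → ⟦ f ⟧ xs ≈ ⟦ f ⟧ ys
  open Algebra public

  eval : ∀ {c ℓ} {X : Set} (A : Algebra c ℓ) → (X → Carrier A) → Term X → Carrier A
  eval A ρ (var x)   = ρ x
  eval A ρ (op f ts) = ⟦_⟧ A f (λ i → eval A ρ (ts i))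

  Equation : Set → Set
  Equation X = Term X × Term X

  HoldsAt : ∀ {c ℓ} {X : Set} (A : Algebra c ℓ) → (X → Carrier A) → Equation X → Set ℓ
  HoldsAt A ρ (s , t) = _≈_ A (eval A ρ s) (eval A ρ t)

  record QuasiIdentity : Set where
    constructor _⇒_
    field
      premises   : List (Equation ℕ)
      conclusion : Equation ℕ
  open QuasiIdentity public

  Sat : ∀ {c ℓ} → Algebra c ℓ → QuasiIdentity → Set (c ⊔ ℓ)
  Sat A q = ∀ (ρ : ℕ → Carrier A) → All (HoldsAt A ρ) (premises q) → HoldsAt A ρ (conclusion q)

  SatStar : ∀ {c ℓ} → Algebra c ℓ → QuasiIdentity → Set (c ⊔ ℓ)
  SatStar A q = ∀ (ρ : ℕ → Carrier A) → ¬ All (HoldsAt A ρ) (premises q)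

  -- A quasivariety: the class of models of a set of quasi-identities.
  Quasivariety : Set₁
  Quasivariety = QuasiIdentity → Set

  _∈Q_ : ∀ {c ℓ} → Algebra c ℓ → Quasivariety → Set (c ⊔ ℓ)
  A ∈Q Q = ∀ q → Q q → Sat A q

  HoldsInQ : Quasivariety → QuasiIdentity → Set₁
  HoldsInQ Q q = ∀ (A : Algebra 0ℓ 0ℓ) → A ∈Q Q → Sat A q

  QEq : Quasivariety → Term ℕ → Term ℕ → Set₁
  QEq Q s t = ∀ (A : Algebra 0ℓ 0ℓ) → A ∈Q Q → ∀ (ρ : ℕ → Carrier A) → HoldsAt A ρ (s , t)

  FreeAlg : Quasivariety → Algebra 0ℓ (lsuc 0ℓ)
  FreeAlg Q = record
    { Carrier       = Term ℕ
    ; _≈_           = QEq Q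
    ; isEquivalence = record
        { refl  = λ A m ρ → IsEquivalence.refl (isEquivalence A)
        ; sym   = λ p A m ρ → IsEquivalence.sym (isEquivalence A) (p A m ρ)
        ; trans = λ p q A m ρ → IsEquivalence.trans (isEquivalence A) (p A m ρ) (q A m ρ)
        }
    ; ⟦_⟧           = op
    ; ⟦⟧-cong       = λ f ps A m ρ → ⟦⟧-cong A f (λ i → ps i A m ρ)
    }

  Active : Quasivariety → QuasiIdentity → Set₁
  Active Q q = Sat (FreeAlg Q) q × ¬ SatStar (FreeAlg Q) q

  AlmostStructurallyComplete : Quasivariety → Set₁
  AlmostStructurallyComplete Q = ∀ q → Active Q q → HoldsInQ Q q

  IsFinite : ∀ {c ℓ} → Algebra c ℓ → Set (c ⊔ ℓ)
  IsFinite A = Σ[ n ∈ ℕ ] Σ[ to ∈ (Carrier A → Fin n) ] Σ[ from ∈ (Fin n → Carrier A) ]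
                 ((∀ x → _≈_ A (from (to x)) x) × (∀ i → to (from i) ≡ i)
                  × (∀ {x y} → _≈_ A x y → to x ≡ to y))

  Nontrivial : ∀ {c ℓ} → Algebra c ℓ → Set (c ⊔ ℓ)
  Nontrivial A = Σ[ x ∈ Carrier A ] Σ[ y ∈ Carrier A ] ¬ (_≈_ A x y)

  record Congruence {c ℓ} (A : Algebra c ℓ) (ℓ' : Level) : Set (c ⊔ ℓ ⊔ lsuc ℓ') where
    field
      rel      : Rel (Carrier A) ℓ'
      isEquiv  : IsEquivalence rel
      ≈⊆rel    : ∀ {x y} → _≈_ A x y → rel x y
      compat   : ∀ f {xs ys : Fin (arity σ f) → Carrier A} →
                 (∀ i → rel (xs i) (ys i)) → rel (⟦_⟧ A f xs) (⟦_⟧ A f ys)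
  open Congruence public

  Quotient : ∀ {c ℓ ℓ'} (A : Algebra c ℓ) → Congruence A ℓ' → Algebra c ℓ'
  Quotient A α = record
    { Carrier = Carrier A ; _≈_ = rel α ; isEquivalence = isEquiv α
    ; ⟦_⟧ = ⟦_⟧ A ; ⟦⟧-cong = compat α }

  QCongruence : ∀ {c ℓ} → Quasivariety → (A : Algebra c ℓ) → Set (c ⊔ lsuc ℓ)
  QCongruence {ℓ = ℓ} Q A = Σ[ α ∈ Congruence A ℓ ] (Quotient A α ∈Q Q)

  IsEquality : ∀ {c ℓ ℓ'} (A : Algebra c ℓ) → Congruence A ℓ' → Set (c ⊔ ℓ ⊔ ℓ')
  IsEquality A α = ∀ x y → rel α x y → _≈_ A x y

  IsTotal : ∀ {c ℓ ℓ'} (A : Algebra c ℓ) → Congruence A ℓ' → Set (c ⊔ ℓ')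
  IsTotal A α = ∀ x y → rel α x y

  QSimple : ∀ {c ℓ} → Quasivariety → Algebra c ℓ → Set (c ⊔ lsuc ℓ)
  QSimple Q A = Nontrivial A ×
    (∀ (α : QCongruence Q A) → IsEquality A (proj₁ α) ⊎ IsTotal A (proj₁ α))

  -- Q-subdirectly irreducible: S ∈ Q, nontrivial, and equality is completely
  -- meet-irreducible in the lattice of Q-congruences (meets = intersections)
  QSubdirectlyIrreducible : ∀ {c ℓ} → Quasivariety → Algebra c ℓ → Set (c ⊔ lsuc ℓ)
  QSubdirectlyIrreducible {ℓ = ℓ} Q S = (S ∈Q Q) × Nontrivial S ×
    (∀ (I : Set ℓ) (α : I → QCongruence Q S) →
       (∀ x y → (∀ i → rel (proj₁ (α i)) x y) → _≈_ S x y) →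
       Σ[ i ∈ I ] IsEquality S (proj₁ (α i)))

  InQCg : ∀ {c ℓ} → Quasivariety → (A : Algebra c ℓ) → (a b c' d : Carrier A) → Set (c ⊔ lsuc ℓ)
  InQCg Q A a b c' d = ∀ (α : QCongruence Q A) → rel (proj₁ α) a b → rel (proj₁ α) c' d

  val4 : ∀ {a} {C : Set a} → C → C → C → C → Fin 4 → C
  val4 u v x y Fin.zero = u
  val4 u v x y (Fin.suc Fin.zero) = v
  val4 u v x y (Fin.suc (Fin.suc Fin.zero)) = x
  val4 u v x y (Fin.suc (Fin.suc (Fin.suc Fin.zero))) = y

  EDPRC : Quasivariety → Set₁
  EDPRC Q = Σ[ eqs ∈ List (Equation (Fin 4)) ]
    (∀ (A : Algebra 0ℓ 0ℓ) → A ∈Q Q → ∀ (a b c' d : Carrier A) →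
       InQCg Q A a b c' d ⇔ All (HoldsAt A (val4 c' d a b)) eqs)

  Class : Set₁
  Class = Algebra 0ℓ 0ℓ → Set

  IdentityOf : Class → Equation ℕ → Set₁
  IdentityOf K e = ∀ (A : Algebra 0ℓ 0ℓ) → K A → ∀ ρ → HoldsAt A ρ e

  VarietyGen : Class → Algebra 0ℓ 0ℓ → Set₁
  VarietyGen K A = ∀ e → IdentityOf K e → ∀ ρ → HoldsAt A ρ e

  FiniteModelProperty : Quasivariety → Set₁
  FiniteModelProperty Q = ∀ (A : Algebra 0ℓ 0ℓ) →
    VarietyGen (λ B → B ∈Q Q) A ⇔ VarietyGen (λ B → (B ∈Q Q) × IsFinite B) A

  Embeds : ∀ {a aℓ b bℓ} → Algebra a aℓ → Algebra b bℓ → Set (a ⊔ aℓ ⊔ b ⊔ bℓ)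
  Embeds A B = Σ[ h ∈ (Carrier A → Carrier B) ]
    ((∀ {x y} → _≈_ A x y → _≈_ B (h x) (h y)) ×
     (∀ {x y} → _≈_ B (h x) (h y) → _≈_ A x y) ×
     (∀ f (xs : Fin (arity σ f) → Carrier A) →
        _≈_ B (h (⟦_⟧ A f xs)) (⟦_⟧ B f (λ i → h (xs i)))))

  _⊗_ : ∀ {a aℓ b bℓ} → Algebra a aℓ → Algebra b bℓ → Algebra (a ⊔ b) (aℓ ⊔ bℓ)
  A ⊗ B = record
    { Carrier = Carrier A × Carrier B
    ; _≈_ = λ p q → _≈_ A (proj₁ p) (proj₁ q) × _≈_ B (proj₂ p) (proj₂ q)
    ; isEquivalence = record
        { refl  = IsEquivalence.refl (isEquivalence A) , IsEquivalence.refl (isEquivalence B)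
        ; sym   = λ p → IsEquivalence.sym (isEquivalence A) (proj₁ p) , IsEquivalence.sym (isEquivalence B) (proj₂ p)
        ; trans = λ p q → IsEquivalence.trans (isEquivalence A) (proj₁ p) (proj₁ q)
                        , IsEquivalence.trans (isEquivalence B) (proj₂ p) (proj₂ q) }
    ; ⟦_⟧ = λ f xs → ⟦_⟧ A f (λ i → proj₁ (xs i)) , ⟦_⟧ B f (λ i → proj₂ (xs i))
    ; ⟦⟧-cong = λ f ps → ⟦⟧-cong A f (λ i → proj₁ (ps i)) , ⟦⟧-cong B f (λ i → proj₂ (ps i))
    }

{-# OPTIONS --safe #-}
-- The Q-simple algebra C makes logic classical for propositions in Set, and F is isomorphic to the
-- Set-valued algebra F₀ of terms modulo derivability, so F may be reasoned about classically.
--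
-- (⇒) Let (a , b) generate the monolith of S. The quasi-identity "diagram of S × C implies
-- (a , c₀) ≈ (b , c₀)" fails in Q, while its premises are satisfied in F through S × C → C → F;
-- so it fails in F, giving a homomorphism h : S × C → F that separates these two points. By EDPRC
-- principal Q-congruences of S × C are products, so ker h is equality on S times equality or the
-- total relation on C, and h embeds S × C, respectively S, in F.
--
-- (⇐) EDPRC and the finite model property reduce validity of a quasi-identity in Q to its finite
-- members, hence to finite Q-subdirectly irreducible S. If S × C embeds in F, a solution of the
-- premises in F is mapped to C by a homomorphism F → C and paired with the one given in S.
module Submission where

open import Defs
open import Level using (Level; 0ℓ; _⊔_)
open import Data.Nat using (ℕ; zero; suc; s≤s; _<_; _*_; _^_; _<?_)
open import Data.Nat.Properties using (≤-refl; ≤-trans)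
open import Data.Fin using (Fin; zero; suc; toℕ; fromℕ<; finToFun; funToFin; combine; remQuot)
open import Data.Fin.Properties
  using (any?; _≟_; injective⇒≤; toℕ<n; fromℕ<-toℕ; finToFun-funToFin; remQuot-combine; combine-remQuot)
open import Data.Product using (Σ-syntax; _×_; _,_; proj₁; proj₂; ∃; ∃₂)
open import Data.Sum as Sum using (_⊎_; inj₁; inj₂)
open import Data.List using (List; []; _∷_; concat; tabulate)
open import Data.List.Relation.Unary.All as All using (All; []; _∷_)
import Data.List.Relation.Unary.All.Properties as All
open import Function.Base using (_∘_; id)
open import Function.Bundles using (_⇔_; mk⇔; Equivalence)
open import Relation.Binary using (Rel; IsEquivalence; Decidable)
open import Relation.Nullary using (¬_; Dec; yes; no; contradiction)
open import Relation.Nullary.Decidable using (decidable-stable)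
open import Relation.Binary.PropositionalEquality using (_≡_; refl; sym; trans; cong; cong₂; subst)

private
  variable
    a b c ℓ ℓ′ ℓ″ : Level

-- Finite combinatorics: decidable quotients of `Fin n` and distributing a disjunction over finitely
-- many cases.

FinitePartition : ∀ {n} → Rel (Fin n) ℓ → Set ℓ
FinitePartition {n = n} R = Σ[ m ∈ ℕ ] Σ[ to ∈ (Fin n → Fin m) ] Σ[ from ∈ (Fin m → Fin n) ]
  ((∀ x → R (from (to x)) x) × (∀ i → to (from i) ≡ i) × (∀ {x y} → R x y → to x ≡ to y))

-- Induction on `n`: by decidability, `zero` either joins the class of some successor, whose
-- representative is kept, or opens a new class with itself as representative.
finite-partition : ∀ n {R : Rel (Fin n) ℓ} → IsEquivalence R → Decidable R → FinitePartition R
finite-partition zero eqv R? = zero , id , id , (λ ()) , (λ ()) , λ { {()} }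
finite-partition (suc n) {R} eqv R? = build
  (finite-partition n record { refl = E.refl ; sym = E.sym ; trans = E.trans }
    (λ x y → R? (suc x) (suc y)))
  (any? (λ j → R? zero (suc j)))
  where
  module E = IsEquivalence eqv
  build : FinitePartition (λ x y → R (suc x) (suc y)) → Dec (∃ λ j → R zero (suc j)) → FinitePartition R
  build (m , to , from , from-to , to-from , to-cong) (yes (j , r)) =
    m , to′ , suc ∘ from , from-to′ , to-from , to-cong′
    where
    to′ : Fin (suc n) → Fin m
    to′ zero    = to j
    to′ (suc x) = to x
    from-to′ : ∀ x → R (suc (from (to′ x))) x
    from-to′ zero    = E.trans (from-to j) (E.sym r)
    from-to′ (suc x) = from-to x
    to-cong′ : ∀ {x y} → R x y → to′ x ≡ to′ y
    to-cong′ {zero}  {zero}  _ = refl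
    to-cong′ {zero}  {suc y} p = to-cong (E.trans (E.sym r) p)
    to-cong′ {suc x} {zero}  p = to-cong (E.trans p r)
    to-cong′ {suc x} {suc y} p = to-cong p
  build (m , to , from , from-to , to-from , to-cong) (no ¬r) =
    suc m , to′ , from′ , from-to′ , to-from′ , to-cong′
    where
    to′ : Fin (suc n) → Fin (suc m)
    to′ zero    = zero
    to′ (suc x) = suc (to x)
    from′ : Fin (suc m) → Fin (suc n)
    from′ zero    = zero
    from′ (suc i) = suc (from i)
    from-to′ : ∀ x → R (from′ (to′ x)) x
    from-to′ zero    = E.refl
    from-to′ (suc x) = from-to x
    to-from′ : ∀ i → to′ (from′ i) ≡ i
    to-from′ zero    = refl
    to-from′ (suc i) = cong suc (to-from i)
    to-cong′ : ∀ {x y} → R x y → to′ x ≡ to′ y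
    to-cong′ {zero}  {zero}  _ = refl
    to-cong′ {zero}  {suc y} p = contradiction (y , p) ¬r
    to-cong′ {suc x} {zero}  p = contradiction (x , E.sym p) ¬r
    to-cong′ {suc x} {suc y} p = cong suc (to-cong p)

-- Constructive because the index set is finite. It makes the relation "x ≈ y or P" compatible with
-- the operations.
∀-⊎-distribʳ : ∀ {n} {R : Fin n → Set a} {P : Set b} → (∀ i → R i ⊎ P) → (∀ i → R i) ⊎ P
∀-⊎-distribʳ {n = zero}  h = inj₁ λ ()
∀-⊎-distribʳ {n = suc n} h with h zero | ∀-⊎-distribʳ (h ∘ suc)
... | inj₂ p | _      = inj₂ p
... | inj₁ _ | inj₂ p = inj₂ p
... | inj₁ r | inj₁ k = inj₁ λ { zero → r ; (suc i) → k i }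

All-⊎-distribʳ : ∀ {A : Set a} {R : A → Set b} {P : Set c} {xs} → All (λ x → R x ⊎ P) xs → All R xs ⊎ P
All-⊎-distribʳ [] = inj₁ []
All-⊎-distribʳ (h ∷ hs) with h | All-⊎-distribʳ hs
... | inj₂ p | _      = inj₂ p
... | inj₁ _ | inj₂ p = inj₂ p
... | inj₁ r | inj₁ k = inj₁ (r ∷ k)

-- Homomorphisms, quotients, products and diagrams of finite algebras.

module _ {σ : Signature} where

  module Eq {c ℓ} (A : Algebra σ c ℓ) = IsEquivalence (isEquivalence A)

  infix 4 _⟨_≈_⟩
  _⟨_≈_⟩ : (A : Algebra σ c ℓ) → Carrier A → Carrier A → Set ℓ
  A ⟨ x ≈ y ⟩ = _≈_ A x y

  record Hom (A : Algebra σ a ℓ) (B : Algebra σ b ℓ′) : Set (a ⊔ b ⊔ ℓ ⊔ ℓ′) where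
    constructor mkHom
    field
      map      : Carrier A → Carrier B
      map-cong : ∀ {x y} → A ⟨ x ≈ y ⟩ → B ⟨ map x ≈ map y ⟩
      map-op   : ∀ f xs → B ⟨ map (⟦_⟧ A f xs) ≈ ⟦_⟧ B f (map ∘ xs) ⟩
  open Hom

  Embeds⇒Hom : (A : Algebra σ a ℓ) (B : Algebra σ b ℓ′) → Embeds σ A B → Hom A B
  Embeds⇒Hom A B (h , h-cong , _ , h-op) = mkHom h h-cong h-op

  eval-cong : ∀ {X : Set} (A : Algebra σ a ℓ) {ρ τ : X → Carrier A} →
    (∀ x → A ⟨ ρ x ≈ τ x ⟩) → ∀ t → A ⟨ eval σ A ρ t ≈ eval σ A τ t ⟩
  eval-cong A p (var x)   = p x
  eval-cong A p (op f ts) = ⟦⟧-cong A f λ i → eval-cong A p (ts i)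

  HoldsAt-cong : ∀ {X : Set} (A : Algebra σ a ℓ) {ρ τ : X → Carrier A} →
    (∀ x → A ⟨ ρ x ≈ τ x ⟩) → ∀ e → HoldsAt σ A ρ e → HoldsAt σ A τ e
  HoldsAt-cong A p (s , t) h =
    Eq.trans A (Eq.sym A (eval-cong A p s)) (Eq.trans A h (eval-cong A p t))

  module _ {A : Algebra σ a ℓ} {B : Algebra σ b ℓ′} (h : Hom A B) {X : Set} (ρ : X → Carrier A) where

    map-eval : ∀ t → B ⟨ map h (eval σ A ρ t) ≈ eval σ B (map h ∘ ρ) t ⟩
    map-eval (var x)   = Eq.refl B
    map-eval (op f ts) = Eq.trans B (map-op h f _) (⟦⟧-cong B f λ i → map-eval (ts i))

    image⇒HoldsAt : ∀ e → B ⟨ map h (eval σ A ρ (proj₁ e)) ≈ map h (eval σ A ρ (proj₂ e)) ⟩ →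
      HoldsAt σ B (map h ∘ ρ) e
    image⇒HoldsAt (s , t) p =
      Eq.trans B (Eq.sym B (map-eval s)) (Eq.trans B p (map-eval t))

    HoldsAt⇒image : ∀ e → HoldsAt σ B (map h ∘ ρ) e →
      B ⟨ map h (eval σ A ρ (proj₁ e)) ≈ map h (eval σ A ρ (proj₂ e)) ⟩
    HoldsAt⇒image (s , t) p =
      Eq.trans B (map-eval s) (Eq.trans B p (Eq.sym B (map-eval t)))

    HoldsAt-map : ∀ e → HoldsAt σ A ρ e → HoldsAt σ B (map h ∘ ρ) e
    HoldsAt-map e p = image⇒HoldsAt e (map-cong h p)

  Sat-embeds : (A : Algebra σ a ℓ) (B : Algebra σ b ℓ′) → Embeds σ A B → ∀ q → Sat σ B q → Sat σ A q
  Sat-embeds A B e@(_ , _ , inj , _) q sat ρ ps =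
    inj (HoldsAt⇒image h ρ (conclusion q) (sat (map h ∘ ρ) (All.map (λ {e} → HoldsAt-map h ρ e) ps)))
    where h = Embeds⇒Hom A B e

  projˡ : (A : Algebra σ a ℓ) (B : Algebra σ b ℓ′) → Hom (_⊗_ σ A B) A
  projˡ A B = mkHom proj₁ proj₁ λ _ _ → Eq.refl A

  projʳ : (A : Algebra σ a ℓ) (B : Algebra σ b ℓ′) → Hom (_⊗_ σ A B) B
  projʳ A B = mkHom proj₂ proj₂ λ _ _ → Eq.refl B

  HoldsAt-⊗ : ∀ {X : Set} (A : Algebra σ a ℓ) (B : Algebra σ b ℓ′) (ρ : X → Carrier A × Carrier B) → ∀ e →
    HoldsAt σ A (proj₁ ∘ ρ) e → HoldsAt σ B (proj₂ ∘ ρ) e → HoldsAt σ (_⊗_ σ A B) ρ e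
  HoldsAt-⊗ A B ρ e p q =
    HoldsAt⇒image (projˡ A B) ρ e p ,
    HoldsAt⇒image (projʳ A B) ρ e q

  -- The map is the identity, yet evaluation in `A` and in the quotient agree only by induction on
  -- terms; equations are moved between the two along this homomorphism.
  quotientHom : (A : Algebra σ a ℓ) (α : Congruence σ A ℓ′) → Hom A (Quotient σ A α)
  quotientHom A α = mkHom id (≈⊆rel α) λ _ _ → IsEquivalence.refl (isEquiv α)

  equality : (A : Algebra σ a ℓ) → Congruence σ A ℓ
  equality A = record { rel = _≈_ A ; isEquiv = isEquivalence A ; ≈⊆rel = id ; compat = ⟦⟧-cong A }

  kernel : {A : Algebra σ a ℓ} {B : Algebra σ b ℓ′} → Hom A B → Congruence σ A ℓ′
  kernel {B = B} h = record
    { rel     = λ x y → B ⟨ map h x ≈ map h y ⟩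
    ; isEquiv = record { refl = Eq.refl B ; sym = Eq.sym B ; trans = Eq.trans B }
    ; ≈⊆rel   = map-cong h
    ; compat  = λ f p → Eq.trans B (map-op h f _)
                          (Eq.trans B (⟦⟧-cong B f p) (Eq.sym B (map-op h f _)))
    }

  Quotient-kernel-embeds : {A : Algebra σ a ℓ} {B : Algebra σ b ℓ′} (h : Hom A B) →
    Embeds σ (Quotient σ A (kernel h)) B
  Quotient-kernel-embeds h = map h , id , id , map-op h

  finite-⊗ : (A : Algebra σ a ℓ) (B : Algebra σ b ℓ′) → IsFinite σ A → IsFinite σ B → IsFinite σ (_⊗_ σ A B)
  finite-⊗ A B (m , toᵃ , fromᵃ , ftᵃ , tfᵃ , congᵃ) (n , toᵇ , fromᵇ , ftᵇ , tfᵇ , congᵇ) =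
    _ , to , from , from-to , to-from , λ (p , q) → cong₂ combine (congᵃ p) (congᵇ q)
    where
    to : Carrier A × Carrier B → Fin (m * n)
    to (x , y) = combine (toᵃ x) (toᵇ y)
    from : Fin (m * n) → Carrier A × Carrier B
    from i = fromᵃ (proj₁ (remQuot {m} n i)) , fromᵇ (proj₂ (remQuot {m} n i))
    from-to : ∀ p → _⊗_ σ A B ⟨ from (to p) ≈ p ⟩
    from-to (x , y) =
      subst (λ r → _⊗_ σ A B ⟨ fromᵃ (proj₁ r) , fromᵇ (proj₂ r) ≈ x , y ⟩)
        (sym (remQuot-combine (toᵃ x) (toᵇ y))) (ftᵃ x , ftᵇ y)
    to-from : ∀ i → to (from i) ≡ i
    to-from i = trans (cong₂ combine (tfᵃ _) (tfᵇ _)) (combine-remQuot {m} n i)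

  finite-quotient : (A : Algebra σ a ℓ) → IsFinite σ A → (α : Congruence σ A ℓ′) →
    Decidable (rel α) → IsFinite σ (Quotient σ A α)
  finite-quotient A (n , to , from , from-to , to-from , to-cong) α α? = build
    (finite-partition n
      record { refl = E.refl ; sym = E.sym ; trans = E.trans } (λ i j → α? (from i) (from j)))
    where
    module E = IsEquivalence (isEquiv α)
    build : FinitePartition (λ i j → rel α (from i) (from j)) → IsFinite σ (Quotient σ A α)
    build (m , to′ , from′ , from-to′ , to-from′ , to-cong′) =
      m , to′ ∘ to , from ∘ from′
      , (λ x → E.trans (from-to′ (to x)) (≈⊆rel α (from-to x)))
      , (λ i → trans (cong to′ (to-from _)) (to-from′ i))
      , λ p → to-cong′ (E.trans (≈⊆rel α (from-to _)) (E.trans p (E.sym (≈⊆rel α (from-to _)))))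

  size : (A : Algebra σ a ℓ) → IsFinite σ A → ℕ
  size A = proj₁

  -- One of u, v is not a chosen class representative; adding it to the
  -- representatives gives an injection from 1 + |A/α| to |A|.
  size-quotient-< : (A : Algebra σ a ℓ) (α : Congruence σ A ℓ′)
    (finA : IsFinite σ A) (finQ : IsFinite σ (Quotient σ A α)) →
    ∀ u v → rel α u v → ¬ A ⟨ u ≈ v ⟩ → size (Quotient σ A α) finQ < size A finA
  size-quotient-< A α (n , to , from , from-to , _ , to-cong) (m , toQ , fromQ , _ , toQ-fromQ , toQ-cong)
    u v uαv u≉v = new (to (fromQ (toQ u)) ≟ to u)
    where
    module E = Eq A
    to-injective : ∀ {x y} → to x ≡ to y → A ⟨ x ≈ y ⟩
    to-injective {x} {y} p =
      E.trans (E.sym (from-to x)) (E.trans (E.reflexive (cong from p)) (from-to y))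

    rep-unique : ∀ {i w} → A ⟨ fromQ i ≈ w ⟩ → i ≡ toQ w
    rep-unique q = trans (sym (toQ-fromQ _)) (toQ-cong (≈⊆rel α q))

    extend : Carrier A → Fin (suc m) → Carrier A
    extend w zero    = w
    extend w (suc i) = fromQ i

    bound : ∀ w → (∀ i → ¬ A ⟨ fromQ i ≈ w ⟩) → m < n
    bound w fresh = injective⇒≤ {f = to ∘ extend w} (λ {i} {j} → inj i j ∘ to-injective)
      where
      inj : ∀ i j → A ⟨ extend w i ≈ extend w j ⟩ → i ≡ j
      inj zero    zero    _ = refl
      inj zero    (suc j) q = contradiction (E.sym q) (fresh j)
      inj (suc i) zero    q = contradiction q (fresh i)
      inj (suc i) (suc j) q = cong suc (trans (rep-unique q) (toQ-fromQ j))

    new : Dec (to (fromQ (toQ u)) ≡ to u) → m < n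
    new (yes p) = bound v λ i q → u≉v (E.trans (E.sym (to-injective p))
      (subst (λ k → A ⟨ fromQ k ≈ v ⟩) (trans (rep-unique q) (sym (toQ-cong uαv))) q))
    new (no ¬p) = bound u λ i q →
      ¬p (to-cong (subst (λ k → A ⟨ fromQ k ≈ u ⟩) (rep-unique q) q))

  -- The diagram of a finite algebra: the i-th variable stands for its i-th element.
  module Diagram {A : Algebra σ a ℓ} (finA : IsFinite σ A) (default : Carrier A) where
    private
      n       = proj₁ finA
      to      = proj₁ (proj₂ finA)
      from    = proj₁ (proj₂ (proj₂ finA))
      from-to = proj₁ (proj₂ (proj₂ (proj₂ finA)))
      to-cong = proj₂ (proj₂ (proj₂ (proj₂ (proj₂ finA))))

    name : Carrier A → ℕ
    name = toℕ ∘ to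

    decode : ℕ → Carrier A
    decode k with k <? n
    ... | yes k<n = from (fromℕ< k<n)
    -- Variables from `n` on do not occur in the diagram, so any value will do.
    ... | no  _   = default

    decode-name : ∀ x → A ⟨ decode (name x) ≈ x ⟩
    decode-name x with name x <? n
    ... | yes p = Eq.trans A (Eq.reflexive A (cong from (fromℕ<-toℕ (to x) p))) (from-to x)
    ... | no ¬p = contradiction (toℕ<n (to x)) ¬p

    -- The index `i` codes a tuple of arguments, so that the table of `f` becomes a finite list.
    equation : ∀ f → Fin (n ^ arity σ f) → Equation σ ℕ
    equation f i =
      op f (var ∘ toℕ ∘ finToFun i) , var (name (⟦_⟧ A f (from ∘ finToFun i)))

    diagram : List (Equation σ ℕ)
    diagram = concat (tabulate λ f → tabulate (equation f))

    decode⊨diagram : All (HoldsAt σ A decode) diagram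
    decode⊨diagram = All.concat⁺ (All.tabulate⁺ λ f → All.tabulate⁺ λ i →
      Eq.trans A (⟦⟧-cong A f λ j → decode-toℕ (finToFun i j)) (Eq.sym A (decode-name _)))
      where
      decode-toℕ : ∀ i → A ⟨ decode (toℕ i) ≈ from i ⟩
      decode-toℕ i with toℕ i <? n
      ... | yes p = Eq.reflexive A (cong from (fromℕ<-toℕ i p))
      ... | no ¬p = contradiction (toℕ<n i) ¬p

    Hom⇒diagram : {B : Algebra σ b ℓ′} (h : Hom A B) → All (HoldsAt σ B (map h ∘ decode)) diagram
    Hom⇒diagram h = All.map (λ {e} → HoldsAt-map h decode e) decode⊨diagram

    diagram⇒Hom : {B : Algebra σ b ℓ′} (ρ : ℕ → Carrier B) → All (HoldsAt σ B ρ) diagram → Hom A B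
    diagram⇒Hom {B = B} ρ sat = mkHom (ρ ∘ name) (B.reflexive ∘ cong (ρ ∘ toℕ) ∘ to-cong) λ f xs →
      -- The diagram only mentions tuples of chosen representatives: `xs` is replaced by the coded
      -- tuple of its labels, which agrees with it pointwise up to `≈`.
      let i = funToFin (to ∘ xs)
          decoded : ∀ j → finToFun i j ≡ to (xs j)
          decoded = finToFun-funToFin (to ∘ xs)
      in B.trans
        (B.reflexive (cong (ρ ∘ toℕ) (to-cong (⟦⟧-cong A f λ j →
          Eq.trans A (Eq.sym A (from-to (xs j))) (Eq.reflexive A (cong from (sym (decoded j))))))))
        (B.trans
          (B.sym (All.tabulate⁻ (All.tabulate⁻ (All.concat⁻ {xss = tabulate λ f → tabulate (equation f)} sat) f) i))
          (⟦⟧-cong B f λ j → B.reflexive (cong (ρ ∘ toℕ) (decoded j))))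
      where module B = Eq B

  -- Excluded middle from simplicity, and the free algebra as terms modulo derivability.

  module _ (Q : Quasivariety σ) where

    private
      F = FreeAlg σ Q

    -- A Q-simple algebra decides every P : Set, since x ≈ y ⊎ P is a Q-congruence.
    QSimple⇒excluded-middle : (A : Algebra σ 0ℓ 0ℓ) → _∈Q_ σ A Q → QSimple σ Q A → (P : Set) → Dec P
    QSimple⇒excluded-middle A A∈Q ((x , y , x≉y) , simple) P = decide (simple (α , α∈Q))
      where
      α : Congruence σ A 0ℓ
      α = record
        { rel     = λ u v → A ⟨ u ≈ v ⟩ ⊎ P
        ; isEquiv = record
          { refl  = inj₁ (Eq.refl A)
          ; sym   = λ { (inj₁ p) → inj₁ (Eq.sym A p) ; (inj₂ p) → inj₂ p }
          ; trans = λ { (inj₁ p) (inj₁ q) → inj₁ (Eq.trans A p q)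
                      ; (inj₁ _) (inj₂ q) → inj₂ q
                      ; (inj₂ p) _        → inj₂ p } }
        ; ≈⊆rel   = inj₁
        ; compat  = λ f ps → Sum.map₁ (⟦⟧-cong A f) (∀-⊎-distribʳ ps)
        }
      α∈Q : _∈Q_ σ (Quotient σ A α) Q
      -- Either all premises already hold in `A`, or one of them supplies `P`, which makes the
      -- conclusion hold trivially.
      α∈Q q Qq ρ ps with All-⊎-distribʳ {R = HoldsAt σ A ρ}
                          (All.map (λ {e} → HoldsAt⇒image (quotientHom A α) ρ e) ps)
      ... | inj₁ qs = HoldsAt-map (quotientHom A α) ρ (conclusion q) (A∈Q q Qq ρ qs)
      ... | inj₂ p  = inj₂ p
      decide : IsEquality σ A α ⊎ IsTotal σ A α → Dec P
      decide (inj₁ eq) = no λ p → x≉y (eq x y (inj₂ p))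
      decide (inj₂ total) with total x y
      ... | inj₁ p = contradiction p x≉y
      ... | inj₂ p = yes p

    evalHom : (A : Algebra σ 0ℓ 0ℓ) → _∈Q_ σ A Q → (ℕ → Carrier A) → Hom F A
    evalHom A A∈Q ρ = mkHom (eval σ A ρ) (λ p → p A A∈Q ρ) λ _ _ → Eq.refl A

    -- Quasi-equational deduction, with `eval σ F τ` acting as substitution by `τ`. Unlike `QEq`,
    -- which quantifies over all algebras, it lives in `Set`, within reach of excluded middle and
    -- EDPRC.
    data Derivable : Term σ ℕ → Term σ ℕ → Set where
      d-refl  : ∀ {t} → Derivable t t
      d-sym   : ∀ {s t} → Derivable s t → Derivable t s
      d-trans : ∀ {s t u} → Derivable s t → Derivable t u → Derivable s u
      d-cong  : ∀ f {ss ts} → (∀ i → Derivable (ss i) (ts i)) → Derivable (op f ss) (op f ts)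
      d-rule  : ∀ q → Q q → (τ : ℕ → Term σ ℕ) →
        All (λ e → Derivable (eval σ F τ (proj₁ e)) (eval σ F τ (proj₂ e))) (premises q) →
        Derivable (eval σ F τ (proj₁ (conclusion q))) (eval σ F τ (proj₂ (conclusion q)))

    -- FreeAlg σ Q with its Set₁-valued equality replaced by a Set-valued one.
    F₀ : Algebra σ 0ℓ 0ℓ
    F₀ = record
      { Carrier       = Term σ ℕ
      ; _≈_           = Derivable
      ; isEquivalence = record { refl = d-refl ; sym = d-sym ; trans = d-trans }
      ; ⟦_⟧           = op
      ; ⟦⟧-cong       = d-cong
      }

    F₀∈Q : _∈Q_ σ F₀ Q
    F₀∈Q q Qq τ ps =
      d-trans (eval-F₀ (proj₁ e)) (d-trans
        (d-rule q Qq τ (All.map (λ {e} p →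
          d-trans (d-sym (eval-F₀ (proj₁ e))) (d-trans p (eval-F₀ (proj₂ e)))) ps))
        (d-sym (eval-F₀ (proj₂ e))))
      where
      e = conclusion q
      eval-F₀ : ∀ t → Derivable (eval σ F₀ τ t) (eval σ F τ t)
      eval-F₀ (var x)   = d-refl
      eval-F₀ (op f ts) = d-cong f λ i → eval-F₀ (ts i)

    Derivable⇒QEq : ∀ {s t} → Derivable s t → QEq σ Q s t
    Derivable⇒QEq d A A∈Q ρ = sound d
      where
      sound : ∀ {s t} → Derivable s t → HoldsAt σ A ρ (s , t)
      -- Mutual recursion over the list, in place of `All.map`, keeps the descent on derivations
      -- structural.
      sound-all : ∀ τ {es} → All (λ e → Derivable (eval σ F τ (proj₁ e)) (eval σ F τ (proj₂ e))) es →
        All (HoldsAt σ A (eval σ A ρ ∘ τ)) es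
      sound d-refl              = Eq.refl A
      sound (d-sym d)           = Eq.sym A (sound d)
      sound (d-trans d d′)      = Eq.trans A (sound d) (sound d′)
      sound (d-cong f ds)       = ⟦⟧-cong A f λ i → sound (ds i)
      sound (d-rule q Qq τ ds)  =
        HoldsAt⇒image (evalHom A A∈Q ρ) τ (conclusion q) (A∈Q q Qq _ (sound-all τ ds))
      sound-all τ {[]}    []       = []
      sound-all τ {e ∷ _} (d ∷ ds) = image⇒HoldsAt (evalHom A A∈Q ρ) τ e (sound d) ∷ sound-all τ ds

    -- Completeness: `F₀` is itself a member of `Q`, and under the assignment `var` each term
    -- evaluates to itself.
    QEq⇒Derivable : ∀ {s t} → QEq σ Q s t → Derivable s t
    QEq⇒Derivable {s} {t} p =
      d-trans (d-sym (eval-var s)) (d-trans (p F₀ F₀∈Q var) (eval-var t))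
      where
      eval-var : ∀ t → Derivable (eval σ F₀ var t) t
      eval-var (var x)   = d-refl
      eval-var (op f ts) = d-cong f λ i → eval-var (ts i)

    FreeAlg-embeds-F₀ : Embeds σ F F₀
    FreeAlg-embeds-F₀ = id , QEq⇒Derivable , Derivable⇒QEq , λ _ _ → d-refl

    F₀-embeds⇒FreeAlg-embeds : (A : Algebra σ a ℓ) → Embeds σ A F₀ → Embeds σ A F
    F₀-embeds⇒FreeAlg-embeds A (h , h-cong , h-inj , h-op) =
      h , Derivable⇒QEq ∘ h-cong , h-inj ∘ QEq⇒Derivable , λ f xs → Derivable⇒QEq (h-op f xs)

    ∈Q-embeds : (A : Algebra σ a ℓ) (B : Algebra σ b ℓ′) → Embeds σ A B → _∈Q_ σ B Q → _∈Q_ σ A Q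
    ∈Q-embeds A B e B∈Q q Qq = Sat-embeds A B e q (B∈Q q Qq)

    ∈Q-⊗ : (A : Algebra σ a ℓ) (B : Algebra σ b ℓ′) → _∈Q_ σ A Q → _∈Q_ σ B Q → _∈Q_ σ (_⊗_ σ A B) Q
    ∈Q-⊗ A B A∈Q B∈Q q Qq ρ ps = HoldsAt-⊗ A B ρ (conclusion q)
      (A∈Q q Qq _ (All.map (λ {e} → HoldsAt-map (projˡ A B) ρ e) ps))
      (B∈Q q Qq _ (All.map (λ {e} → HoldsAt-map (projʳ A B) ρ e) ps))

    val4-map : {A : Set a} {B : Set b} (f : A → B) {u v x y : A} →
      ∀ i → f (val4 σ u v x y i) ≡ val4 σ (f u) (f v) (f x) (f y) i
    val4-map f zero                   = refl
    val4-map f (suc zero)             = refl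
    val4-map f (suc (suc zero))       = refl
    val4-map f (suc (suc (suc zero))) = refl

    -- Principal relative congruences and reduction to finite algebras.

    module PrincipalCongruence (edprc : EDPRC σ Q) where

      eqs = proj₁ edprc

      -- EDPRC brings the `Set₁`-valued `InQCg` down to `Set`; the record wrapper lets the four
      -- elements be inferred.
      record InCg (A : Algebra σ 0ℓ 0ℓ) (a b c d : Carrier A) : Set where
        constructor inCg
        field equations : All (HoldsAt σ A (val4 σ c d a b)) eqs
      open InCg

      module _ (A : Algebra σ 0ℓ 0ℓ) (A∈Q : _∈Q_ σ A Q) where

        InCg⇒InQCg : ∀ {a b c d} → InCg A a b c d → InQCg σ Q A a b c d
        InCg⇒InQCg (inCg es) = Equivalence.from (proj₂ edprc A A∈Q _ _ _ _) es

        InQCg⇒InCg : ∀ {a b c d} → InQCg σ Q A a b c d → InCg A a b c d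
        InQCg⇒InCg p = inCg (Equivalence.to (proj₂ edprc A A∈Q _ _ _ _) p)

        -- This is the intersection of all Q-congruences `α` containing `(a , b)`. Its quotient lies
        -- in `Q` because premises pass to each quotient by such an `α`, where the conclusion
        -- follows.
        Cg : (a b : Carrier A) → QCongruence σ Q A
        Cg a b = θ , λ q Qq ρ ps → InQCg⇒InCg λ α aαb →
            let h = toQuotient α aαb in
            HoldsAt⇒image h ρ (conclusion q) (proj₂ α q Qq ρ (All.map (λ {e} → HoldsAt-map h ρ e) ps))
          where
          module E (α : QCongruence σ Q A) = IsEquivalence (isEquiv (proj₁ α))
          θ : Congruence σ A 0ℓ
          θ = record
            { rel     = InCg A a b
            ; isEquiv = record
              { refl  = InQCg⇒InCg λ α _ → E.refl α
              ; sym   = λ p → InQCg⇒InCg λ α r → E.sym α (InCg⇒InQCg p α r)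
              ; trans = λ p q → InQCg⇒InCg λ α r → E.trans α (InCg⇒InQCg p α r) (InCg⇒InQCg q α r) }
            ; ≈⊆rel   = λ p → InQCg⇒InCg λ α _ → ≈⊆rel (proj₁ α) p
            ; compat  = λ f ps → InQCg⇒InCg λ α r → compat (proj₁ α) f λ i → InCg⇒InQCg (ps i) α r
            }
          toQuotient : (α : QCongruence σ Q A) → rel (proj₁ α) a b → Hom (Quotient σ A θ) (Quotient σ A (proj₁ α))
          toQuotient α aαb = mkHom id (λ p → InCg⇒InQCg p α aαb) λ _ _ → E.refl α

        InCg-base : ∀ {a b} → InCg A a b a b
        InCg-base = InQCg⇒InCg λ α r → r

      -- By EDPRC membership is a conjunction of equations, which hold componentwise.
      InCg-⊗ : {A B : Algebra σ 0ℓ 0ℓ} {a b c d : Carrier A} {a′ b′ c′ d′ : Carrier B} →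
        InCg A a b c d → InCg B a′ b′ c′ d′ → InCg (_⊗_ σ A B) (a , a′) (b , b′) (c , c′) (d , d′)
      InCg-⊗ {A} {B} (inCg ps) (inCg qs) = inCg (All.zipWith (λ {e} (p , q) → HoldsAt-⊗ A B _ e
        (HoldsAt-cong A (λ i → Eq.reflexive A (sym (val4-map proj₁ i))) e p)
        (HoldsAt-cong B (λ i → Eq.reflexive B (sym (val4-map proj₂ i))) e q)) (ps , qs))

      -- By EDPRC the premise s ≈ t can be traded for the equations expressing (c , d) ∈ Cg(s , t).
      valid-in-finite⇒valid : FiniteModelProperty σ Q → ((P : Set) → Dec P) → ∀ ps e →
        ((B : Algebra σ 0ℓ 0ℓ) → _∈Q_ σ B Q → IsFinite σ B → Sat σ B (ps ⇒ e)) →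
        HoldsInQ σ Q (ps ⇒ e)
      valid-in-finite⇒valid fmp em [] e valid A A∈Q ρ [] =
        -- With no premises left, `e` is an identity of the finite members, hence of the variety
        -- they generate, which contains `A`.
        Equivalence.to (fmp A) (λ _ holds → holds A A∈Q) e
          (λ B (B∈Q , finB) τ → valid B B∈Q finB τ []) ρ
      valid-in-finite⇒valid fmp em ((s , t) ∷ ps) (c , d) valid A A∈Q ρ (s≈t ∷ hs) =
        InCg⇒InQCg A A∈Q
          (inCg (All.tabulate λ {e} e∈eqs → instance⇒ A A∈Q ρ e
            -- Recursion on the premises, with one call for each EDPRC equation instantiated at `c`,
            -- `d`, `s`, `t`.
            (valid-in-finite⇒valid fmp em ps (inst e)
              (λ B B∈Q finB τ hs → instance⇐ B B∈Q τ e (All.lookup (equations (premise∈Cg B B∈Q τ finB hs)) e∈eqs))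
              A A∈Q ρ hs)))
          -- As `s ≈ t` holds at `ρ`, the congruence generated by this pair lies inside equality.
          (equality A , A∈Q) s≈t
        where
        τ₀ : Fin 4 → Term σ ℕ
        τ₀ = val4 σ c d s t
        inst : Equation σ (Fin 4) → Equation σ ℕ
        inst (l , r) = eval σ F τ₀ l , eval σ F τ₀ r
        module _ (B : Algebra σ 0ℓ 0ℓ) (B∈Q : _∈Q_ σ B Q) (τ : ℕ → Carrier B) where
          ev = eval σ B τ
          ev-val4 : ∀ i → B ⟨ ev (τ₀ i) ≈ val4 σ (ev c) (ev d) (ev s) (ev t) i ⟩
          ev-val4 i = Eq.reflexive B (val4-map ev i)
          instance⇒ : ∀ e → HoldsAt σ B τ (inst e) → HoldsAt σ B (val4 σ (ev c) (ev d) (ev s) (ev t)) e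
          instance⇒ e p = HoldsAt-cong B ev-val4 e (image⇒HoldsAt (evalHom B B∈Q τ) τ₀ e p)
          instance⇐ : ∀ e → HoldsAt σ B (val4 σ (ev c) (ev d) (ev s) (ev t)) e → HoldsAt σ B τ (inst e)
          instance⇐ e p = HoldsAt⇒image (evalHom B B∈Q τ) τ₀ e (HoldsAt-cong B (Eq.sym B ∘ ev-val4) e p)
          premise∈Cg : IsFinite σ B → All (HoldsAt σ B τ) ps → InCg B (ev s) (ev t) (ev c) (ev d)
          -- Any quotient of `B` in `Q` identifying `s` and `t` is again finite, by `em`, and
          -- satisfies all premises; validity there identifies `c` and `d`.
          premise∈Cg finB hs = InQCg⇒InCg B B∈Q λ α sαt →
            let h = quotientHom B (proj₁ α) in
            HoldsAt⇒image h τ (c , d)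
              (valid (Quotient σ B (proj₁ α)) (proj₂ α)
                (finite-quotient B finB (proj₁ α) λ x y → em (rel (proj₁ α) x y)) τ
                (image⇒HoldsAt h τ (s , t) sαt ∷ All.map (λ {e} → HoldsAt-map h τ e) hs))

  -- Monoliths and the two implications.

  module _ (Q : Quasivariety σ) (fmp : FiniteModelProperty σ Q) (edprc : EDPRC σ Q)
           (C : Algebra σ 0ℓ 0ℓ) (finC : IsFinite σ C) (simple : QSimple σ Q C)
           (C-embeds : Embeds σ C (FreeAlg σ Q)) where

    private
      F = FreeAlg σ Q

    open PrincipalCongruence Q edprc

    C∈Q : _∈Q_ σ C Q
    C∈Q = ∈Q-embeds Q C F C-embeds (∈Q-embeds Q F (F₀ Q) (FreeAlg-embeds-F₀ Q) (F₀∈Q Q))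

    em : (P : Set) → Dec P
    em = QSimple⇒excluded-middle Q C C∈Q simple

    by-contradiction : {P : Set} → ¬ ¬ P → P
    by-contradiction = decidable-stable (em _)

    -- The pair generates the monolith. Quantifying over principal congruences only keeps this in
    -- `Set`, where `em` applies.
    Monolithic : (S : Algebra σ 0ℓ 0ℓ) → Carrier S → Carrier S → Set
    Monolithic S a b = ¬ S ⟨ a ≈ b ⟩ × (∀ u v → ¬ S ⟨ u ≈ v ⟩ → InCg S u v a b)

    -- If no pair worked, the congruences `Cg u v` with `u ≉ v` would meet in equality, so one of
    -- them would be equality while containing `(u , v)`.
    monolith : (S : Algebra σ 0ℓ 0ℓ) → QSubdirectlyIrreducible σ Q S → ∃₂ (Monolithic S)
    monolith S (S∈Q , _ , irreducible) = by-contradiction λ none →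
      let ((u , v , u≉v) , isEq) = irreducible
            (Σ[ u ∈ Carrier S ] Σ[ v ∈ Carrier S ] ¬ S ⟨ u ≈ v ⟩) (λ (u , v , _) → Cg S S∈Q u v)
            λ x y all → by-contradiction λ x≉y → none (x , y , x≉y , λ u v u≉v → all (u , v , u≉v))
      in u≉v (isEq u v (InCg-base S S∈Q))

    -- A Q-congruence other than equality contains `(a , b)`, so a family of such congruences cannot
    -- meet in equality.
    Monolithic⇒QSubdirectlyIrreducible : (S : Algebra σ 0ℓ 0ℓ) → _∈Q_ σ S Q → ∀ {a b} →
      Monolithic S a b → QSubdirectlyIrreducible σ Q S
    Monolithic⇒QSubdirectlyIrreducible S S∈Q {a} {b} (a≉b , least) =
      S∈Q , (a , b , a≉b) , λ I α meet → by-contradiction λ none → a≉b (meet a b λ i →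
        by-contradiction λ ¬aαb → none (i , λ u v uαv → by-contradiction λ u≉v →
          ¬aαb (InCg⇒InQCg S S∈Q (least u v u≉v) (α i) uαv)))

    InCg-C : ∀ {u v} → ¬ C ⟨ u ≈ v ⟩ → ∀ x y → InCg C u v x y
    InCg-C {u} {v} u≉v with proj₂ simple (Cg C C∈Q u v)
    ... | inj₁ isEq  = contradiction (isEq u v (InCg-base C C∈Q)) u≉v
    ... | inj₂ total = total

    InCg-refl : (A : Algebra σ 0ℓ 0ℓ) → _∈Q_ σ A Q → ∀ {u v x} → InCg A u v x x
    InCg-refl A A∈Q = IsEquivalence.refl (isEquiv (proj₁ (Cg A A∈Q _ _)))

    module _ (S : Algebra σ 0ℓ 0ℓ) (S∈Q : _∈Q_ σ S Q) {a b : Carrier S} (mono : Monolithic S a b)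
             (c₀ : Carrier C) where

      private
        P = _⊗_ σ S C
        P∈Q = ∈Q-⊗ Q S C S∈Q C∈Q

      separating-Hom⇒embeds : (h : Hom P (F₀ Q)) → ¬ F₀ Q ⟨ map h (a , c₀) ≈ map h (b , c₀) ⟩ →
        Embeds σ S (F₀ Q) ⊎ Embeds σ P (F₀ Q)
      separating-Hom⇒embeds h separates = decide (em _)
        where
        module F₀ = Eq (F₀ Q)

        infix 4 _~_
        _~_ : Carrier P → Carrier P → Set
        p ~ q = F₀ Q ⟨ map h p ≈ map h q ⟩

        θ : QCongruence σ Q P
        θ = kernel h , ∈Q-embeds Q _ (F₀ Q) (Quotient-kernel-embeds h) (F₀∈Q Q)

        generated : ∀ {u u′ v v′} → (u , v) ~ (u′ , v′) →
          ∀ {x x′ y y′} → InCg S u u′ x x′ → InCg C v v′ y y′ → (x , y) ~ (x′ , y′)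
        generated p xx′ yy′ = InCg⇒InQCg P P∈Q (InCg-⊗ xx′ yy′) θ p

        injective-S : ∀ {u u′ v v′} → (u , v) ~ (u′ , v′) → S ⟨ u ≈ u′ ⟩
        -- Otherwise the collapse spreads to the monolith pair in the first coordinate, with `c₀`
        -- kept fixed in the second.
        injective-S p = by-contradiction λ u≉u′ →
          separates (generated p (proj₂ mono _ _ u≉u′) (InCg-refl C C∈Q))

        decide : Dec (∃₂ λ p q → p ~ q × ¬ C ⟨ proj₂ p ≈ proj₂ q ⟩) → Embeds σ S (F₀ Q) ⊎ Embeds σ P (F₀ Q)
        decide (yes (_ , _ , p~q , v≉v′)) = inj₁
          ( (λ s → map h (s , c₀))
          , (λ p → map-cong h (p , Eq.refl C))
          , injective-S
          -- An operation need not fix `c₀`, but the kernel is total on the `C` coordinate, so its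
          -- value there can be replaced by `c₀`.
          , λ f xs → F₀.trans (generated p~q (InCg-refl S S∈Q) (InCg-C v≉v′ _ _)) (map-op h f λ i → xs i , c₀))
        decide (no ¬∃) = inj₂
          ( map h , map-cong h
          , (λ p~q → injective-S p~q , by-contradiction λ v≉v′ → ¬∃ (_ , _ , p~q , v≉v′))
          , map-op h)

    ASC⇒embeds : AlmostStructurallyComplete σ Q → (S : Algebra σ 0ℓ 0ℓ) → IsFinite σ S →
      QSubdirectlyIrreducible σ Q S → Embeds σ S F ⊎ Embeds σ (_⊗_ σ S C) F
    ASC⇒embeds asc S finS si@(S∈Q , _) =
      Sum.map (F₀-embeds⇒FreeAlg-embeds Q S) (F₀-embeds⇒FreeAlg-embeds Q P)
        (separating-Hom⇒embeds S S∈Q mono c₀ (diagram⇒Hom ρ ρ⊨diagram) separates)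
      where
      P    = _⊗_ σ S C
      c₀   = proj₁ (proj₁ simple)
      x₀   = proj₁ (monolith S si)
      y₀   = proj₁ (proj₂ (monolith S si))
      mono = proj₂ (proj₂ (monolith S si))

      open Diagram {A = P} (finite-⊗ S C finS finC) (x₀ , c₀)

      q : QuasiIdentity σ
      q = diagram ⇒ (var (name (x₀ , c₀)) , var (name (y₀ , c₀)))

      q-fails-in-P : ¬ Sat σ P q
      q-fails-in-P sat = proj₁ mono (proj₁ (Eq.trans P (Eq.sym P (decode-name (x₀ , c₀)))
        (Eq.trans P (sat decode decode⊨diagram) (decode-name (y₀ , c₀)))))

      C-hom : Hom C F
      C-hom = Embeds⇒Hom C F C-embeds

      P-hom : Hom P F
      P-hom = mkHom (map C-hom ∘ proj₂) (map-cong C-hom ∘ proj₂) λ f xs → map-op C-hom f (proj₂ ∘ xs)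

      q-fails-in-F₀ : ¬ Sat σ (F₀ Q) q
      -- If `q` held it would be active, since `P-hom` satisfies its premises in `F`, and then it
      -- would hold in `P`.
      q-fails-in-F₀ sat = q-fails-in-P (asc q
        (Sat-embeds F (F₀ Q) (FreeAlg-embeds-F₀ Q) q sat , λ star → star _ (Hom⇒diagram P-hom))
        P (∈Q-⊗ Q S C S∈Q C∈Q))

      counterexample : Σ[ ρ ∈ (ℕ → Term σ ℕ) ]
        All (HoldsAt σ (F₀ Q) ρ) diagram × ¬ HoldsAt σ (F₀ Q) ρ (conclusion q)
      counterexample = by-contradiction λ none → q-fails-in-F₀ λ ρ ps →
        by-contradiction λ ¬c → none (ρ , ps , ¬c)

      ρ         = proj₁ counterexample
      ρ⊨diagram = proj₁ (proj₂ counterexample)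
      separates = proj₂ (proj₂ counterexample)

    embeds⇒ASC : (∀ (S : Algebra σ 0ℓ 0ℓ) → IsFinite σ S → QSubdirectlyIrreducible σ Q S →
        Embeds σ S F ⊎ Embeds σ (_⊗_ σ S C) F) → AlmostStructurallyComplete σ Q
    embeds⇒ASC embed q (F⊨q , ¬star) =
      valid-in-finite⇒valid fmp em (premises q) (conclusion q)
        λ B B∈Q finB → finite-Sat (suc (size B finB)) B B∈Q finB ≤-refl
      where
      si-Sat : ∀ S → IsFinite σ S → QSubdirectlyIrreducible σ Q S → Sat σ S q
      si-Sat S finS si ρ ps with embed S finS si
      ... | inj₁ e = Sat-embeds S F e q F⊨q ρ ps
      -- `¬star` yields no explicit solution `τ`, so it is used against the assumption that the
      -- conclusion fails.
      ... | inj₂ e = by-contradiction λ ¬l≈r → ¬star λ τ hs →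
        let g  = evalHom Q C C∈Q (λ _ → proj₁ (proj₁ simple))
            ρg = λ k → ρ k , map g (τ k)
        in ¬l≈r (HoldsAt-map (projˡ S C) ρg (conclusion q) (Sat-embeds (_⊗_ σ S C) F e q F⊨q ρg
             (All.zipWith (λ {e} (p , h) → HoldsAt-⊗ S C ρg e p (HoldsAt-map g τ e h)) (ps , hs))))

      -- A failure of q in B survives in some proper quotient B/Cg(u , v), unless B is Q-subdirectly irreducible.
      finite-Sat : ∀ n B → _∈Q_ σ B Q → (finB : IsFinite σ B) → size B finB < n → Sat σ B q
      finite-Sat (suc n) B B∈Q finB (s≤s size≤n) ρ ps = by-contradiction λ ¬l≈r → refute ¬l≈r (em _)
        where
        l = eval σ B ρ (proj₁ (conclusion q))
        r = eval σ B ρ (proj₂ (conclusion q))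
        refute : ¬ B ⟨ l ≈ r ⟩ →
          ¬ Dec (∃₂ λ u v → ¬ B ⟨ u ≈ v ⟩ × ¬ InCg B u v l r)
        refute ¬l≈r (yes (u , v , u≉v , ¬lr)) = ¬lr (HoldsAt⇒image h ρ (conclusion q)
          (finite-Sat n B/α (proj₂ α) fin
            (≤-trans (size-quotient-< B (proj₁ α) finB fin u v (InCg-base B B∈Q) u≉v) size≤n) ρ
            (All.map (λ {e} → HoldsAt-map h ρ e) ps)))
          where
          α   = Cg B B∈Q u v
          B/α = Quotient σ B (proj₁ α)
          h   = quotientHom B (proj₁ α)
          fin = finite-quotient B finB (proj₁ α) λ x y → em _
        -- Now `(l , r)` lies in every nontrivial principal congruence, so it generates a monolith
        -- of `B`.
        refute ¬l≈r (no none) = ¬l≈r (si-Sat B finB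
          (Monolithic⇒QSubdirectlyIrreducible B B∈Q
            (¬l≈r , λ u v u≉v → by-contradiction λ ¬lr → none (u , v , u≉v , ¬lr))) ρ ps)

theorem6p1 : (σ : Signature) (Q : Quasivariety σ) →
    FiniteModelProperty σ Q → EDPRC σ Q →
    (C : Algebra σ 0ℓ 0ℓ) → IsFinite σ C → QSimple σ Q C → Embeds σ C (FreeAlg σ Q) →
    (AlmostStructurallyComplete σ Q ⇔
    (∀ (S : Algebra σ 0ℓ 0ℓ) → IsFinite σ S → QSubdirectlyIrreducible σ Q S →
    Embeds σ S (FreeAlg σ Q) ⊎ Embeds σ (_⊗_ σ S C) (FreeAlg σ Q)))
theorem6p1 σ Q fmp edprc C finC simple C-embeds = mk⇔
  (ASC⇒embeds Q fmp edprc C finC simple C-embeds)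
  (embeds⇒ASC Q fmp edprc C finC simple C-embeds)
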